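{- Let $m\le n$ be positive integers and let $\rho:\{0,1\}^n\to\{0,1\}^n$ be the generalized rotation with parameter $m$. Let $w\in\{0,1\}^n$, let $p$ be the smallest positive integer with $\rho^p(w)=w$, and let $a(w)$ be the number of $1$'s in $w$. For $j=1,\dots,n$ define the multisets \[ L^{(j)}=\Big\{\textstyle\sum_{i=0}^{j-1}\rho^k(w)_i \;\Big|\; k=0,1,\dots,p-1\Big\},\qquad R^{(j)}=\Big\{\textstyle\sum_{i=0}^{j-1}\rho^k(w)_{n-i-1} \;\Big|\; k=0,1,\dots,p-1\Big\}, \] (each with $p$ elements counted with multiplicity), and let $L^{(0)}=R^{(0)}$ be the multiset consisting of $p$ copies of $0$. Then for $j=0,1,\dots,n-1$ we have $L^{(j)}=R^{(j)}$ as multisets, i.e. for every $s\in\{0,1,\dots,a(w)\}$, \[ \#\Big\{k\in\{0,\dots,p-1\}: \textstyle\sum_{i=0}^{j-1}\rho^k(w)_i=s\Big\}=\#\Big\{k\in\{0,\dots,p-1\}: \textstyle\sum_{i=0}^{j-1}\rho^k(w)_{n-i-1}=s\Big\}. \]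
   Context: For a word $w=w_0w_1\cdots w_{n-1}\in\{0,1\}^n$, $w_i$ is its $i$-th letter and $w_{[i,j]}=w_iw_{i+1}\cdots w_j$. The generalized rotation $\rho$ (with parameter $m$, $1\le m\le n$) is defined by: if there is $k<m$ such that $w_{[0,k]}=1^k0$ (i.e. $w$ begins with exactly $k$ ones followed by a $0$), then $\rho(w)=w_{k+1}w_{k+2}\cdots w_{n-1}\,0\,1^k$; otherwise (i.e. $w$ begins with $m$ ones) $\rho(w)=w_mw_{m+1}\cdots w_{n-1}1^m$. Here $1^k$ denotes $k$ consecutive ones. $\rho$ is a bijection, and for $m=1$ it is the ordinary cyclic shift. $\rho^k(w)_i$ denotes the $i$-th letter of $\rho^k(w)$. -}

module Defs where

open import Data.Nat using (ℕ; zero; suc; _+_; _<_; _≟_)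
open import Data.Bool using (Bool; true; false)
open import Data.List using (List; []; _∷_; _++_; drop; take; replicate; reverse; map; filter; length; upTo)
open import Relation.Binary.PropositionalEquality using (_≡_)
open import Data.Nat.ListAction using (sum)
open import Data.Product using (_×_)
open import Relation.Binary.PropositionalEquality using (_≢_)
open import Data.Nat using (_<?_)
open import Relation.Nullary using (yes; no)

-- Binary words are lists of Bool (true = 1, false = 0), of length n.

leadOnes : ℕ → List Bool → ℕ
leadOnes zero    _            = zero
leadOnes (suc m) (true ∷ w)   = suc (leadOnes m w)
leadOnes (suc m) _            = zero

-- generalized rotation with parameter m
-- if w = 1^k 0 u with k < m:  ρ(w) = u 0 1^k
-- otherwise (w begins with 1^m): ρ(w) = w_[m..] 1^m
ρ : ℕ → List Bool → List Bool
ρ m w with leadOnes m w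
... | k with k <? m
...   | yes _ = drop (suc k) w ++ (false ∷ replicate k true)
...   | no  _ = drop m w ++ replicate m true

ρ^ : ℕ → ℕ → List Bool → List Bool
ρ^ m zero    w = w
ρ^ m (suc k) w = ρ m (ρ^ m k w)

b2n : Bool → ℕ
b2n true  = 1
b2n false = 0

ones : List Bool → ℕ
ones w = sum (map b2n w)

leftSum : ℕ → List Bool → ℕ
leftSum j w = ones (take j w)

rightSum : ℕ → List Bool → ℕ
rightSum j w = ones (take j (reverse w))

IsPeriod : ℕ → List Bool → ℕ → Set
IsPeriod m w p = (0 < p) × (ρ^ m p w ≡ w) × (∀ q → 0 < q → q < p → ρ^ m q w ≢ w)

count : ℕ → ℕ → List Bool → (List Bool → ℕ) → ℕ → ℕ
count m p w f s = length (filter (λ k → f (ρ^ m k w) ≟ s) (upTo p))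

{-# OPTIONS --safe #-}

-- Let zl j w and zr j w be the numbers of zeros among the first and the last j letters
-- of w, and let Ω f j w be the sum, over the zeros of w, of f (number of zeros among the
-- j letters following that zero).  Replacing "following" by "preceding" gives the same
-- sum.  Hence if ρ v = v′ moves a token 1ᵏ0, evaluating Ω on v01ᵏ = 1ᵏ0v′ from both ends
-- yields f (zl j v′) + Ω v′ = Ω v + f (zr j v).  Applied to the complementary letters,
-- this also relates f (zl j v) to f (zr j v′).  A token 1ᵐ keeps Ω and turns zl (m + j)
-- into zl j.  Summed over a periodic orbit the Ω terms cancel, so the sums of f ∘ zl j
-- and f ∘ zr j differ by as much as those for m + j, and they agree for j ≤ m.
module Submission where

open import Defs
open import Data.Nat using (ℕ; zero; suc; _+_; _*_; _∸_; _⊓_; _≤_; _<_; z≤n; s≤s; _≟_; _≤?_; _<?_; >-nonZero)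
open import Data.Nat.Properties
open import Data.Nat.DivMod using (_/_; _%_; m≡m%n+[m/n]*n; m%n<n)
open import Data.Nat.Tactic.RingSolver using (solve)
open import Data.Bool using (Bool; true; false; not)
open import Data.List using (List; []; _∷_; _++_; _∷ʳ_; length; take; drop; replicate; reverse; filter; upTo)
open import Data.List.Properties using (++-assoc; length-++; length-replicate; length-reverse; length-take; unfold-reverse; reverse-++; upTo-∷ʳ; filter-++)
open import Data.Product using (_,_)
open import Function using (_∘_)
open import Relation.Nullary using (yes; no; does; contradiction)
open import Relation.Binary.PropositionalEquality using (_≡_; refl; sym; trans; cong; cong₂; subst; module ≡-Reasoning)

-- Zeros in prefixes and suffixes.

1^ : ℕ → List Bool
1^ k = replicate k true

zeros : List Bool → ℕ
zeros []      = 0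
zeros (b ∷ w) = b2n (not b) + zeros w

zl zr : ℕ → List Bool → ℕ
zl j w = zeros (take j w)
zr j w = zl j (reverse w)

zeros-++ : ∀ u v → zeros (u ++ v) ≡ zeros u + zeros v
zeros-++ []      v = refl
zeros-++ (b ∷ u) v = trans (cong (b2n (not b) +_) (zeros-++ u v))
                           (sym (+-assoc (b2n (not b)) (zeros u) (zeros v)))

zeros-swap : ∀ u v → zeros (u ++ v) ≡ zeros (v ++ u)
zeros-swap u v = begin
  zeros (u ++ v)     ≡⟨ zeros-++ u v ⟩
  zeros u + zeros v  ≡⟨ +-comm (zeros u) (zeros v) ⟩
  zeros v + zeros u  ≡⟨ zeros-++ v u ⟨
  zeros (v ++ u)     ∎
  where open ≡-Reasoning

zeros-reverse : ∀ w → zeros (reverse w) ≡ zeros w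
zeros-reverse []      = refl
zeros-reverse (b ∷ w) = begin
  zeros (reverse (b ∷ w))       ≡⟨ cong zeros (unfold-reverse b w) ⟩
  zeros (reverse w ∷ʳ b)        ≡⟨ zeros-swap (reverse w) (b ∷ []) ⟩
  b2n (not b) + zeros (reverse w)  ≡⟨ cong (b2n (not b) +_) (zeros-reverse w) ⟩
  zeros (b ∷ w)                 ∎
  where open ≡-Reasoning

ones+zeros : ∀ w → ones w + zeros w ≡ length w
ones+zeros []          = refl
ones+zeros (true ∷ w)  = cong suc (ones+zeros w)
ones+zeros (false ∷ w) = trans (+-suc (ones w) (zeros w)) (cong suc (ones+zeros w))

reverse-1^ : ∀ k → reverse (1^ k) ≡ 1^ k
reverse-1^ zero    = refl
reverse-1^ (suc k) = trans (unfold-reverse true (1^ k))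
                           (trans (cong (_∷ʳ true) (reverse-1^ k)) (1^-∷ʳ k))
  where
  1^-∷ʳ : ∀ k → 1^ k ∷ʳ true ≡ 1^ (suc k)
  1^-∷ʳ zero    = refl
  1^-∷ʳ (suc k) = cong (true ∷_) (1^-∷ʳ k)

zl-all : ∀ j w → length w ≤ j → zl j w ≡ zeros w
zl-all zero    []      _         = refl
zl-all (suc j) []      _         = refl
zl-all (suc j) (b ∷ w) (s≤s w≤j) = cong (b2n (not b) +_) (zl-all j w w≤j)

zl-++ : ∀ j w u → j ≤ length w → zl j (w ++ u) ≡ zl j w
zl-++ zero    w       u _         = refl
zl-++ (suc j) (b ∷ w) u (s≤s j≤w) = cong (b2n (not b) +_) (zl-++ j w u j≤w)

zl-1^ : ∀ j k → zl j (1^ k) ≡ 0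
zl-1^ zero    k       = refl
zl-1^ (suc j) zero    = refl
zl-1^ (suc j) (suc k) = zl-1^ j k

zl-1^-++ : ∀ k j u → zl (k + j) (1^ k ++ u) ≡ zl j u
zl-1^-++ zero    j u = refl
zl-1^-++ (suc k) j u = zl-1^-++ k j u

-- Beyond the end of `u` the window meets ones or nothing, and neither counts as a zero, so `j` can
-- be arbitrary.
zl-++-1^ : ∀ j u k → zl j (u ++ 1^ k) ≡ zl j u
zl-++-1^ zero    u       k = refl
zl-++-1^ (suc j) []      k = zl-1^ (suc j) k
zl-++-1^ (suc j) (b ∷ u) k = cong (b2n (not b) +_) (zl-++-1^ j u k)

zr-1^-++ : ∀ k j u → zr j (1^ k ++ u) ≡ zr j u
zr-1^-++ k j u = begin
  zl j (reverse (1^ k ++ u))          ≡⟨ cong (zl j) (reverse-++ (1^ k) u) ⟩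
  zl j (reverse u ++ reverse (1^ k))  ≡⟨ cong (λ x → zl j (reverse u ++ x)) (reverse-1^ k) ⟩
  zl j (reverse u ++ 1^ k)            ≡⟨ zl-++-1^ j (reverse u) k ⟩
  zl j (reverse u)                    ∎
  where open ≡-Reasoning

reverse-++-1^ : ∀ u k → reverse (u ++ 1^ k) ≡ 1^ k ++ reverse u
reverse-++-1^ u k = trans (reverse-++ u (1^ k)) (cong (_++ reverse u) (reverse-1^ k))

zr-++-1^ : ∀ k j u → zr (k + j) (u ++ 1^ k) ≡ zr j u
zr-++-1^ k j u = trans (cong (zl (k + j)) (reverse-++-1^ u k)) (zl-1^-++ k j (reverse u))

-- The prefix and the suffix partition the word. This trades prefix counts for suffix counts of the
-- complementary length.
zl+zr : ∀ j i w → j + i ≡ length w → zl j w + zr i w ≡ zeros w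
zl+zr zero    i w       eq = trans (zl-all i (reverse w) (≤-reflexive (trans (length-reverse w) (sym eq))))
                                   (zeros-reverse w)
zl+zr (suc j) i (b ∷ w) eq = begin
  b2n (not b) + zl j w + zl i (reverse (b ∷ w))
    ≡⟨ cong (λ x → b2n (not b) + zl j w + zl i x) (unfold-reverse b w) ⟩
  b2n (not b) + zl j w + zl i (reverse w ∷ʳ b)
    ≡⟨ cong (b2n (not b) + zl j w +_) (zl-++ i (reverse w) (b ∷ []) i≤) ⟩
  b2n (not b) + zl j w + zr i w
    ≡⟨ +-assoc (b2n (not b)) (zl j w) (zr i w) ⟩
  b2n (not b) + (zl j w + zr i w)
    ≡⟨ cong (b2n (not b) +_) (zl+zr j i w (suc-injective eq)) ⟩
  b2n (not b) + zeros w ∎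
  where
  open ≡-Reasoning
  i≤ : i ≤ length (reverse w)
  i≤ = subst (i ≤_) (trans (suc-injective eq) (sym (length-reverse w))) (m≤n+m i j)

-- The potential `Ω`, with windows cut off at the end of the word.

Ω : (ℕ → ℕ) → ℕ → List Bool → ℕ
Ω f j []          = 0
Ω f j (true ∷ w)  = Ω f j w
Ω f j (false ∷ w) = f (zl j w) + Ω f j w

module _ (f : ℕ → ℕ) (j : ℕ) where

  Ω-1^-++ : ∀ k u → Ω f j (1^ k ++ u) ≡ Ω f j u
  Ω-1^-++ zero    u = refl
  Ω-1^-++ (suc k) u = Ω-1^-++ k u

  Ω-++-1^ : ∀ u k → Ω f j (u ++ 1^ k) ≡ Ω f j u
  Ω-++-1^ []          zero    = refl
  Ω-++-1^ []          (suc k) = Ω-++-1^ [] k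
  Ω-++-1^ (true ∷ u)  k       = Ω-++-1^ u k
  Ω-++-1^ (false ∷ u) k       = cong₂ (λ x y → f x + y) (zl-++-1^ j u k) (Ω-++-1^ u k)

  -- The appended and the prepended zero see each other exactly when w is shorter than j.
  zl-∷ʳ-exchange : ∀ w → f (zl j (w ∷ʳ false)) + f (zr j w) ≡ f (zl j w) + f (zr j (false ∷ w))
  zl-∷ʳ-exchange w rewrite unfold-reverse false w with j ≤? length w
  ... | yes j≤w
    rewrite zl-++ j w (false ∷ []) j≤w
          | zl-++ j (reverse w) (false ∷ []) (subst (j ≤_) (sym (length-reverse w)) j≤w)
    = refl
  ... | no j≰w = begin
    f (zl j (w ∷ʳ false)) + f (zr j w)
      ≡⟨ cong₂ (λ x y → f x + f y) (long w w<j) (short (reverse w) w′<j) ⟩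
    f (suc (zeros w)) + f (zeros (reverse w))
      ≡⟨ +-comm (f (suc (zeros w))) _ ⟩
    f (zeros (reverse w)) + f (suc (zeros w))
      ≡⟨ cong₂ (λ x y → f x + f (suc y)) (zeros-reverse w) (sym (zeros-reverse w)) ⟩
    f (zeros w) + f (suc (zeros (reverse w)))
      ≡⟨ cong₂ (λ x y → f x + f y) (short w w<j) (long (reverse w) w′<j) ⟨
    f (zl j w) + f (zl j (reverse w ∷ʳ false)) ∎
    where
    open ≡-Reasoning
    w<j : length w < j
    w<j = ≰⇒> j≰w
    w′<j : length (reverse w) < j
    w′<j = subst (_< j) (sym (length-reverse w)) w<j
    short : ∀ w → length w < j → zl j w ≡ zeros w
    short w lt = zl-all j w (<⇒≤ lt)
    long : ∀ w → length w < j → zl j (w ∷ʳ false) ≡ suc (zeros w)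
    long w lt = trans
      (zl-all j (w ∷ʳ false) (≤-trans (≤-reflexive (trans (length-++ w) (+-comm (length w) 1))) lt))
      (zeros-swap w (false ∷ []))

  -- Counted with preceding windows, the new zero adds only its own window and leaves all others as
  -- they were. The induction carries the new zero's term past each leading zero by
  -- `zl-∷ʳ-exchange`.
  Ω-∷ʳ-false : ∀ w → Ω f j (w ∷ʳ false) ≡ Ω f j w + f (zr j w)
  Ω-∷ʳ-false [] = +-identityʳ _
  Ω-∷ʳ-false (true ∷ w) = begin
    Ω f j (w ∷ʳ false)             ≡⟨ Ω-∷ʳ-false w ⟩
    Ω f j w + f (zr j w)           ≡⟨ cong (λ x → Ω f j w + f x) (zr-1^-++ 1 j w) ⟨
    Ω f j w + f (zr j (true ∷ w))  ∎
    where open ≡-Reasoning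
  Ω-∷ʳ-false (false ∷ w) = begin
    f (zl j (w ∷ʳ false)) + Ω f j (w ∷ʳ false)
      ≡⟨ cong (f (zl j (w ∷ʳ false)) +_) (Ω-∷ʳ-false w) ⟩
    f (zl j (w ∷ʳ false)) + (Ω f j w + f (zr j w))
      ≡⟨ rotate (f (zl j (w ∷ʳ false))) (Ω f j w) (f (zr j w)) ⟩
    f (zl j (w ∷ʳ false)) + f (zr j w) + Ω f j w
      ≡⟨ cong (_+ Ω f j w) (zl-∷ʳ-exchange w) ⟩
    f (zl j w) + f (zr j (false ∷ w)) + Ω f j w
      ≡⟨ rotate′ (f (zl j w)) (f (zr j (false ∷ w))) (Ω f j w) ⟩
    f (zl j w) + Ω f j w + f (zr j (false ∷ w)) ∎
    where
    open ≡-Reasoning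
    rotate : ∀ x y z → x + (y + z) ≡ x + z + y
    rotate x y z = solve (x ∷ y ∷ z ∷ [])
    rotate′ : ∀ x y z → x + y + z ≡ x + z + y
    rotate′ x y z = solve (x ∷ y ∷ z ∷ [])

  Ω-++-false-1^ : ∀ u k → Ω f j (u ++ false ∷ 1^ k) ≡ Ω f j u + f (zr j u)
  Ω-++-false-1^ u k = begin
    Ω f j (u ++ false ∷ 1^ k)    ≡⟨ cong (Ω f j) (++-assoc u (false ∷ []) (1^ k)) ⟨
    Ω f j (u ∷ʳ false ++ 1^ k)   ≡⟨ Ω-++-1^ (u ∷ʳ false) k ⟩
    Ω f j (u ∷ʳ false)           ≡⟨ Ω-∷ʳ-false u ⟩
    Ω f j u + f (zr j u)         ∎
    where open ≡-Reasoning

  Ω-rotate : ∀ k u → let v = 1^ k ++ false ∷ u ; v′ = u ++ false ∷ 1^ k in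
             f (zl j v′) + Ω f j v′ ≡ Ω f j v + f (zr j v)
  Ω-rotate k u = begin
    -- This is the left side unfolded. Prefixing `1^ k` costs nothing and gives `1ᵏ0u01ᵏ`, which can
    -- also be read as `v` followed by `01ᵏ`.
    Ω f j (false ∷ (u ++ false ∷ 1^ k))
      ≡⟨ Ω-1^-++ k _ ⟨
    Ω f j (1^ k ++ (false ∷ u) ++ false ∷ 1^ k)
      ≡⟨ cong (Ω f j) (++-assoc (1^ k) (false ∷ u) (false ∷ 1^ k)) ⟨
    Ω f j ((1^ k ++ false ∷ u) ++ false ∷ 1^ k)
      ≡⟨ Ω-++-false-1^ (1^ k ++ false ∷ u) k ⟩
    Ω f j (1^ k ++ false ∷ u) + f (zr j (1^ k ++ false ∷ u)) ∎
    where open ≡-Reasoning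

-- The generalized rotation as a move of one token.

data Step (m : ℕ) : List Bool → List Bool → Set where
  short : ∀ k u → Step m (1^ k ++ false ∷ u) (u ++ false ∷ 1^ k)
  long  : ∀ u → Step m (1^ m ++ u) (u ++ 1^ m)

-- The index `k` is the value of `leadOnes`, so one match fixes both the shape of the word and the
-- branch taken by `ρ`.
data Parse (m : ℕ) : ℕ → List Bool → Set where
  short : ∀ k u → k < m → Parse m k (1^ k ++ false ∷ u)
  long  : ∀ u → Parse m m (1^ m ++ u)

-- The length bound excludes words made of fewer than `m` ones, which start with no token.
parse : ∀ m w → m ≤ length w → Parse m (leadOnes m w) w
parse zero    w           _ = long w
parse (suc m) (false ∷ w) _ = short 0 w (s≤s z≤n)
parse (suc m) (true ∷ w)  (s≤s m≤w) with leadOnes m w | parse m w m≤w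
... | _ | short k u k<m = short (suc k) u (s≤s k<m)
... | _ | long u        = long u

drop-1^ : ∀ k u → drop k (1^ k ++ u) ≡ u
drop-1^ zero    u = refl
drop-1^ (suc k) u = drop-1^ k u

drop-1^-false : ∀ k u → drop (suc k) (1^ k ++ false ∷ u) ≡ u
drop-1^-false zero    u = refl
drop-1^-false (suc k) u = drop-1^-false k u

ρ-step : ∀ m w → m ≤ length w → Step m w (ρ m w)
ρ-step m w m≤w with leadOnes m w | parse m w m≤w
... | k | p with k <? m | p
...   | yes _   | short _ u _   rewrite drop-1^-false k u = short k u
...   | yes m<m | long _        = contradiction m<m (<-irrefl refl)
...   | no k≮m  | short _ _ k<m = contradiction k<m k≮m
...   | no _    | long u        rewrite drop-1^ m u = long u

length-swap : ∀ (u v : List Bool) → length (u ++ v) ≡ length (v ++ u)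
length-swap u v = trans (length-++ u) (trans (+-comm (length u) _) (sym (length-++ v)))

short-length : ∀ k u → length (1^ k ++ false ∷ u) ≡ length (u ++ false ∷ 1^ k)
short-length k u = begin
  length (1^ k ++ false ∷ u)   ≡⟨ length-swap (1^ k) (false ∷ u) ⟩
  suc (length (u ++ 1^ k))     ≡⟨ cong suc (length-swap u (1^ k)) ⟩
  length (false ∷ 1^ k ++ u)   ≡⟨ length-swap (false ∷ 1^ k) u ⟩
  length (u ++ false ∷ 1^ k)   ∎
  where open ≡-Reasoning

short-zeros : ∀ k u → zeros (1^ k ++ false ∷ u) ≡ zeros (u ++ false ∷ 1^ k)
short-zeros k u = begin
  zeros (1^ k ++ false ∷ u)   ≡⟨ zeros-swap (1^ k) (false ∷ u) ⟩
  suc (zeros (u ++ 1^ k))     ≡⟨ cong suc (zeros-swap u (1^ k)) ⟩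
  zeros (false ∷ 1^ k ++ u)   ≡⟨ zeros-swap (false ∷ 1^ k) u ⟩
  zeros (u ++ false ∷ 1^ k)   ∎
  where open ≡-Reasoning

step-length : ∀ {m v w} → Step m v w → length v ≡ length w
step-length (short k u) = short-length k u
step-length (long u)    = length-swap (1^ _) u

step-zeros : ∀ {m v w} → Step m v w → zeros v ≡ zeros w
step-zeros (short k u) = short-zeros k u
step-zeros (long u)    = zeros-swap (1^ _) u

-- Balance identities for a single step.

module _ (f : ℕ → ℕ) where

  -- With `g = f ∘ (N ∸_)`, complementary windows give `f (zl j v) = g (zr i v)` and
  -- `f (zr j v′) = g (zl i v′)`, which reduces the claim to `Ω-rotate` for `g` and `i`.
  Ω-rotate-complement : ∀ k u j i N → let v = 1^ k ++ false ∷ u ; v′ = u ++ false ∷ 1^ k in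
    j + i ≡ length v → zeros v ≡ N →
    f (zl j v) + Ω (f ∘ (N ∸_)) i v ≡ f (zr j v′) + Ω (f ∘ (N ∸_)) i v′
  Ω-rotate-complement k u j i N len refl = begin
    f (zl j v) + Ω g i v          ≡⟨ cong (λ x → f x + Ω g i v) (m+n≡o⇒m≡o∸n (zl+zr j i v len)) ⟩
    g (zr i v) + Ω g i v          ≡⟨ +-comm (g (zr i v)) _ ⟩
    Ω g i v + g (zr i v)          ≡⟨ Ω-rotate g i k u ⟨
    g (zl i v′) + Ω g i v′        ≡⟨ cong (λ x → f x + Ω g i v′) (m+n≡o⇒m≡o∸n zr+zl) ⟨
    f (zr j v′) + Ω g i v′        ∎
    where
    open ≡-Reasoning
    v v′ : List Bool
    v = 1^ k ++ false ∷ u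
    v′ = u ++ false ∷ 1^ k
    g : ℕ → ℕ
    g = f ∘ (N ∸_)
    m+n≡o⇒m≡o∸n : ∀ {a b c} → a + b ≡ c → a ≡ c ∸ b
    m+n≡o⇒m≡o∸n {a} {b} refl = sym (m+n∸n≡m a b)
    zr+zl : zr j v′ + zl i v′ ≡ N
    zr+zl = begin
      zr j v′ + zl i v′  ≡⟨ +-comm (zr j v′) _ ⟩
      zl i v′ + zr j v′  ≡⟨ zl+zr i j v′ (trans (+-comm i j) (trans len (short-length k u))) ⟩
      zeros v′           ≡⟨ short-zeros k u ⟨
      N                  ∎

  -- A long token leaves `Ω` unchanged, and for `j ≤ m` the first `j` letters of `v` and the last
  -- `j` letters of `w` both lie inside it.
  short-j-balance : ∀ {m v w} j i N → j ≤ m → Step m v w → j + i ≡ length v → zeros v ≡ N →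
    f (zl j v) + Ω (f ∘ (N ∸_)) i v ≡ f (zr j w) + Ω (f ∘ (N ∸_)) i w
  short-j-balance j i N j≤m (short k u) len zs = Ω-rotate-complement k u j i N len zs
  short-j-balance {m = m} j i N j≤m (long u) len zs
    rewrite Ω-1^-++ (f ∘ (N ∸_)) i m u | Ω-++-1^ (f ∘ (N ∸_)) i u m
          | reverse-++-1^ u m
          | zl-++ j (1^ m) u (subst (j ≤_) (sym (length-replicate m)) j≤m)
          | zl-++ j (1^ m) (reverse u) (subst (j ≤_) (sym (length-replicate m)) j≤m)
    = refl

  -- Windows of length `m + j` can stick out of a long token, and then the complement identity alone
  -- may fail. Adding `Ω-rotate` at `j` repairs this: for a long token, `zl (m + j) v = zl j w` and
  -- `zr j v = zr (m + j) w`, so the terms match crosswise.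
  long-j-balance : ∀ {m v w} j i N → Step m v w → m + j + i ≡ length v → zeros v ≡ N →
    let g = f ∘ (N ∸_) in
    f (zl (m + j) v) + f (zr j v) + (Ω f j v + Ω g i v) ≡
    f (zr (m + j) w) + f (zl j w) + (Ω f j w + Ω g i w)
  long-j-balance {m} {v} {w} j i N (short k u) len zs = begin
    f (zl (m + j) v) + f (zr j v) + (Ω f j v + Ω g i v)
      ≡⟨ shuffle (f (zl (m + j) v)) (f (zr j v)) (Ω f j v) (Ω g i v) ⟩
    (Ω f j v + f (zr j v)) + (f (zl (m + j) v) + Ω g i v)
      ≡⟨ cong₂ _+_ (sym (Ω-rotate f j k u)) (Ω-rotate-complement k u (m + j) i N len zs) ⟩
    (f (zl j w) + Ω f j w) + (f (zr (m + j) w) + Ω g i w)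
      ≡⟨ shuffle′ (f (zl j w)) (Ω f j w) (f (zr (m + j) w)) (Ω g i w) ⟩
    f (zr (m + j) w) + f (zl j w) + (Ω f j w + Ω g i w) ∎
    where
    open ≡-Reasoning
    g : ℕ → ℕ
    g = f ∘ (N ∸_)
    shuffle : ∀ a b c d → a + b + (c + d) ≡ (c + b) + (a + d)
    shuffle a b c d = solve (a ∷ b ∷ c ∷ d ∷ [])
    shuffle′ : ∀ a b c d → (a + b) + (c + d) ≡ c + a + (b + d)
    shuffle′ a b c d = solve (a ∷ b ∷ c ∷ d ∷ [])
  long-j-balance {m = m} j i N (long u) len zs
    rewrite Ω-1^-++ (f ∘ (N ∸_)) i m u | Ω-++-1^ (f ∘ (N ∸_)) i u m
          | Ω-1^-++ f j m u | Ω-++-1^ f j u m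
          | zl-1^-++ m j u | zl-++-1^ j u m | zr-1^-++ m j u | zr-++-1^ m j u
    = cong (_+ (Ω f j u + Ω (f ∘ (N ∸_)) i u)) (+-comm (f (zl j u)) (f (zr j u)))

-- Finite sums, telescoping and counting.

∑ : ℕ → (ℕ → ℕ) → ℕ
∑ zero    h = 0
∑ (suc p) h = ∑ p h + h p

∑-cong : ∀ p {g h : ℕ → ℕ} → (∀ k → g k ≡ h k) → ∑ p g ≡ ∑ p h
∑-cong zero    eq = refl
∑-cong (suc p) eq = cong₂ _+_ (∑-cong p eq) (eq p)

∑-+ : ∀ p (g h : ℕ → ℕ) → ∑ p (λ k → g k + h k) ≡ ∑ p g + ∑ p h
∑-+ zero    g h = refl
∑-+ (suc p) g h = trans (cong (_+ (g p + h p)) (∑-+ p g h)) (interchange (∑ p g) (∑ p h) (g p) (h p))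
  where
  interchange : ∀ a b c d → a + b + (c + d) ≡ a + c + (b + d)
  interchange a b c d = solve (a ∷ b ∷ c ∷ d ∷ [])

-- `B` is read one step later than `A`; the boundary terms `B 0` and `B p` shift its sum back to the
-- same range. Keeping them as addends on both sides avoids truncated subtraction.
∑-telescope : ∀ (A B Φ : ℕ → ℕ) → (∀ k → A k + Φ k ≡ B (suc k) + Φ (suc k)) →
              ∀ p → ∑ p A + (B 0 + Φ 0) ≡ ∑ p B + (B p + Φ p)
∑-telescope A B Φ step zero    = refl
∑-telescope A B Φ step (suc p) = begin
  ∑ p A + A p + (B 0 + Φ 0)                ≡⟨ swap (∑ p A) (A p) (B 0 + Φ 0) ⟩
  ∑ p A + (B 0 + Φ 0) + A p                ≡⟨ cong (_+ A p) (∑-telescope A B Φ step p) ⟩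
  ∑ p B + (B p + Φ p) + A p                ≡⟨ regroup (∑ p B) (B p) (Φ p) (A p) ⟩
  ∑ p B + B p + (A p + Φ p)                ≡⟨ cong (∑ p B + B p +_) (step p) ⟩
  ∑ p B + B p + (B (suc p) + Φ (suc p))    ∎
  where
  open ≡-Reasoning
  swap : ∀ a b c → a + b + c ≡ a + c + b
  swap a b c = solve (a ∷ b ∷ c ∷ [])
  regroup : ∀ a b c d → a + (b + c) + d ≡ a + b + (d + c)
  regroup a b c d = solve (a ∷ b ∷ c ∷ d ∷ [])

-- Phrased through `filter` so that it unfolds to the same decision as one entry of `count`.
indicator : ℕ → ℕ → ℕ
indicator s x = length (filter (_≟ s) (x ∷ []))

count-∑ : ∀ m p w F s → count m p w F s ≡ ∑ p (λ k → indicator s (F (ρ^ m k w)))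
count-∑ m zero    w F s = refl
count-∑ m (suc p) w F s = begin
  length (filter P? (upTo (suc p)))
    ≡⟨ cong (length ∘ filter P?) (upTo-∷ʳ p) ⟨
  length (filter P? (upTo p ∷ʳ p))
    ≡⟨ cong length (filter-++ P? (upTo p) (p ∷ [])) ⟩
  length (filter P? (upTo p) ++ filter P? (p ∷ []))
    ≡⟨ length-++ (filter P? (upTo p)) ⟩
  count m p w F s + length (filter P? (p ∷ []))
    ≡⟨ cong₂ _+_ (count-∑ m p w F s) last ⟩
  ∑ (suc p) (λ k → indicator s (F (ρ^ m k w))) ∎
  where
  open ≡-Reasoning
  P? = λ k → F (ρ^ m k w) ≟ s
  last : length (filter P? (p ∷ [])) ≡ indicator s (F (ρ^ m p w))
  last with does (F (ρ^ m p w) ≟ s)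
  ... | true  = refl
  ... | false = refl

-- Balance along a periodic orbit.

module Orbit (m n : ℕ) (m≤n : m ≤ n) (w : List Bool) (|w|≡n : length w ≡ n)
             (p : ℕ) (ρᵖw≡w : ρ^ m p w ≡ w) where

  orbit : ℕ → List Bool
  orbit k = ρ^ m k w

  -- Proved together with `orbit-step`: the step at time `k` needs the length there, and the length
  -- at `k + 1` comes from that step.
  orbit-length : ∀ k → length (orbit k) ≡ n
  orbit-step   : ∀ k → Step m (orbit k) (orbit (suc k))

  orbit-length zero    = |w|≡n
  orbit-length (suc k) = trans (sym (step-length (orbit-step k))) (orbit-length k)

  orbit-step k = ρ-step m (orbit k) (subst (m ≤_) (sym (orbit-length k)) m≤n)

  orbit-zeros : ∀ k → zeros (orbit k) ≡ zeros w
  orbit-zeros zero    = refl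
  orbit-zeros (suc k) = trans (sym (step-zeros (orbit-step k))) (orbit-zeros k)

  -- At time `p` the orbit is back at `w`, so the boundary terms left by telescoping coincide and
  -- cancel.
  ∑-balance : ∀ (A B Φ : List Bool → ℕ) →
    (∀ k → A (orbit k) + Φ (orbit k) ≡ B (orbit (suc k)) + Φ (orbit (suc k))) →
    ∑ p (A ∘ orbit) ≡ ∑ p (B ∘ orbit)
  ∑-balance A B Φ step = +-cancelʳ-≡ (B w + Φ w) _ _
    (trans (∑-telescope (A ∘ orbit) (B ∘ orbit) (Φ ∘ orbit) step p)
           (cong (λ x → ∑ p (B ∘ orbit) + (B x + Φ x)) ρᵖw≡w))

  -- Equality of two multisets, expressed by testing against every `f`.
  Balanced : ℕ → Set
  Balanced j = ∀ f → ∑ p (f ∘ zl j ∘ orbit) ≡ ∑ p (f ∘ zr j ∘ orbit)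

  balanced-≤m : ∀ j → j ≤ m → Balanced j
  balanced-≤m j j≤m f =
    ∑-balance (f ∘ zl j) (f ∘ zr j) (Ω (f ∘ (zeros w ∸_)) (n ∸ j)) λ k →
      short-j-balance f j (n ∸ j) (zeros w) j≤m (orbit-step k)
        (trans (m+[n∸m]≡n (≤-trans j≤m m≤n)) (sym (orbit-length k))) (orbit-zeros k)

  -- After summation, the terms at `j` in `long-j-balance` agree by the hypothesis on `j` and
  -- cancel, leaving those at `m + j`.
  balanced-m+ : ∀ j → m + j ≤ n → Balanced j → Balanced (m + j)
  balanced-m+ j m+j≤n balanced f = +-cancelʳ-≡ (∑ p (f ∘ zr j ∘ orbit)) _ _ (begin
    ∑ p (f ∘ zl (m + j) ∘ orbit) + ∑ p (f ∘ zr j ∘ orbit)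
      ≡⟨ ∑-+ p _ _ ⟨
    ∑ p (λ k → f (zl (m + j) (orbit k)) + f (zr j (orbit k)))
      ≡⟨ ∑-balance (λ v → f (zl (m + j) v) + f (zr j v)) (λ v → f (zr (m + j) v) + f (zl j v))
           (λ v → Ω f j v + Ω (f ∘ (zeros w ∸_)) (n ∸ (m + j)) v)
           (λ k → long-j-balance f j (n ∸ (m + j)) (zeros w) (orbit-step k)
                    (trans (m+[n∸m]≡n m+j≤n) (sym (orbit-length k))) (orbit-zeros k)) ⟩
    ∑ p (λ k → f (zr (m + j) (orbit k)) + f (zl j (orbit k)))
      ≡⟨ ∑-+ p _ _ ⟩
    ∑ p (f ∘ zr (m + j) ∘ orbit) + ∑ p (f ∘ zl j ∘ orbit)
      ≡⟨ cong (∑ p (f ∘ zr (m + j) ∘ orbit) +_) (balanced f) ⟩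
    ∑ p (f ∘ zr (m + j) ∘ orbit) + ∑ p (f ∘ zr j ∘ orbit) ∎)
    where open ≡-Reasoning

  balanced-multiple : ∀ q r → r ≤ m → q * m + r ≤ n → Balanced (q * m + r)
  balanced-multiple zero    r r≤m _  = balanced-≤m r r≤m
  balanced-multiple (suc q) r r≤m le rewrite +-assoc m (q * m) r =
    balanced-m+ (q * m + r) le (balanced-multiple q r r≤m (≤-trans (m≤n+m _ m) le))

  -- Division with remainder: start from `j % m` and climb `j / m` times by `m`.
  balanced : 1 ≤ m → ∀ j → j ≤ n → Balanced j
  balanced 1≤m j j≤n = subst Balanced (sym j≡)
    (balanced-multiple (j / m) (j % m) (<⇒≤ (m%n<n j m)) (subst (_≤ n) j≡ j≤n))
    where
    instance _ = >-nonZero 1≤m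
    j≡ : j ≡ j / m * m + j % m
    j≡ = trans (m≡m%n+[m/n]*n j m) (+-comm (j % m) _)

  -- `r` is the identity for `leftSum` and `reverse` for `rightSum`. Since `j ≤ n`, the window has
  -- exactly `j` letters, so its zeros determine its ones.
  count-ones-take : ∀ j s → j ≤ n →
    ∀ (r : List Bool → List Bool) → (∀ v → length (r v) ≡ length v) →
    count m p w (ones ∘ take j ∘ r) s ≡ ∑ p (λ k → indicator s (j ∸ zl j (r (orbit k))))
  count-ones-take j s j≤n r |r| = trans (count-∑ m p w (ones ∘ take j ∘ r) s) (∑-cong p λ k →
    cong (indicator s) (ones≡ (r (orbit k)) (trans (|r| (orbit k)) (orbit-length k))))
    where
    ones≡ : ∀ v → length v ≡ n → ones (take j v) ≡ j ∸ zl j v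
    ones≡ v |v|≡n = begin
      ones (take j v)                      ≡⟨ m+n∸n≡m _ (zl j v) ⟨
      ones (take j v) + zl j v ∸ zl j v    ≡⟨ cong (_∸ zl j v) (ones+zeros (take j v)) ⟩
      length (take j v) ∸ zl j v           ≡⟨ cong (_∸ zl j v) (length-take j v) ⟩
      j ⊓ length v ∸ zl j v                ≡⟨ cong (_∸ zl j v) (m≤n⇒m⊓n≡m (subst (j ≤_) (sym |v|≡n) j≤n)) ⟩
      j ∸ zl j v                           ∎
      where open ≡-Reasoning

theorem1 : (m n : ℕ) → 1 ≤ m → m ≤ n →
    (w : List Bool) → length w ≡ n →
    (p : ℕ) → IsPeriod m w p →
    (j : ℕ) → j < n →
    (s : ℕ) → s ≤ ones w →
    count m p w (leftSum j) s ≡ count m p w (rightSum j) s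
theorem1 m n 1≤m m≤n w |w|≡n p (_ , ρᵖw≡w , _) j j<n s _ = begin
  count m p w (leftSum j) s                      ≡⟨ count-ones-take j s j≤n (λ v → v) (λ _ → refl) ⟩
  -- The test function `indicator s ∘ (j ∸_)` selects the windows with `s` ones.
  ∑ p (λ k → indicator s (j ∸ zl j (orbit k)))   ≡⟨ balanced 1≤m j j≤n (indicator s ∘ (j ∸_)) ⟩
  ∑ p (λ k → indicator s (j ∸ zr j (orbit k)))   ≡⟨ count-ones-take j s j≤n reverse length-reverse ⟨
  count m p w (rightSum j) s                     ∎
  where
  open ≡-Reasoning
  open Orbit m n m≤n w |w|≡n p ρᵖw≡w
  j≤n : j ≤ n
  j≤n = <⇒≤ j<n
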